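{- Let $\Psi$ be any set of good $\mathcal{L}_\bullet$-sequents. Then the following hold. (1) A consecution $\Gamma\vdash\phi$ is derivable in $\mathsf{G_{BDFNL}}(\odot\Psi)$ if and only if $\mathsf{Alg}^+(\Psi)\models\Gamma\vdash\phi$. (2) If, for each sequent $\chi\vdash\delta$ in $\Psi$, every propositional variable occurring in $\delta$ also occurs in $\chi$, then $\mathsf{G_{BDFNL}}(\odot\Psi)$ has the subformula property: in any derivation of a consecution $\Gamma\vdash\phi$, all formulas occurring are subformulas of $\Gamma,\phi$.
   Context: $\mathcal{L}_{\mathrm{LC}}$-formulas are built from propositional variables and $\top,\bot$ using $\wedge,\vee,\to,\bullet,\leftarrow$; $\mathcal{L}_\bullet$-formulas are built from propositional variables and $\top,\bot$ using only $\bullet$. An $\mathcal{L}_\bullet$-sequent $\chi\vdash\delta$ ($\chi,\delta$ $\mathcal{L}_\bullet$-formulas) is good if each propositional variable occurs at most once in $\chi$. Structures: $\Gamma::=\phi\mid(\Gamma\odot\Gamma)\mid(\Gamma\barwedge\Gamma)$ with $\phi$ an $\mathcal{L}_{\mathrm{LC}}$-formula. A consecution is $\Gamma\vdash\phi$ with $\Gamma$ a structure and $\phi$ an $\mathcal{L}_{\mathrm{LC}}$-formula. A context $\Gamma[-]$ is a structure with a hole, and $\Gamma[\Delta]$ is the result of filling the hole with the structure $\Delta$. The formula $\tau(\Gamma)$ is defined by $\tau(\phi)=\phi$, $\tau(\Gamma\odot\Delta)=\tau(\Gamma)\bullet\tau(\Delta)$, $\tau(\Gamma\barwedge\Delta)=\tau(\Gamma)\wedge\tau(\Delta)$.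 $\mathsf{G_{BDFNL}}$ has: Axioms: $\phi\vdash\phi$; $\Gamma\vdash\top$; $\Gamma[\bot]\vdash\phi$. Logical rules: from $\Delta\vdash\phi$ and $\Gamma[\psi]\vdash\gamma$ infer $\Gamma[\Delta\odot(\phi\to\psi)]\vdash\gamma$; from $\phi\odot\Gamma\vdash\psi$ infer $\Gamma\vdash\phi\to\psi$; from $\Gamma[\phi]\vdash\gamma$ and $\Delta\vdash\psi$ infer $\Gamma[(\phi\leftarrow\psi)\odot\Delta]\vdash\gamma$; from $\Gamma\odot\psi\vdash\phi$ infer $\Gamma\vdash\phi\leftarrow\psi$; from $\Gamma[\phi\odot\psi]\vdash\gamma$ infer $\Gamma[\phi\bullet\psi]\vdash\gamma$; from $\Gamma\vdash\phi$ and $\Delta\vdash\psi$ infer $\Gamma\odot\Delta\vdash\phi\bullet\psi$; from $\Gamma[\phi\barwedge\psi]\vdash\gamma$ infer $\Gamma[\phi\wedge\psi]\vdash\gamma$; from $\Gamma\vdash\phi$ and $\Delta\vdash\psi$ infer $\Gamma\barwedge\Delta\vdash\phi\wedge\psi$; from $\Gamma[\phi]\vdash\gamma$ and $\Gamma[\psi]\vdash\gamma$ infer $\Gamma[\phi\vee\psi]\vdash\gamma$; from $\Gamma\vdash\phi_i$ infer $\Gamma\vdash\phi_1\vee\phi_2$ ($i=1,2$). Structural rules: from $\Gamma[\Delta\barwedge\Delta]\vdash\phi$ infer $\Gamma[\Delta]\vdash\phi$; from $\Gamma[\Delta]\vdash\phi$ infer $\Gamma[\Sigma\barwedge\Delta]\vdash\phi$;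 from $\Gamma[\Delta\barwedge\Lambda]\vdash\phi$ infer $\Gamma[\Lambda\barwedge\Delta]\vdash\phi$; from $\Gamma[(\Delta_1\barwedge\Delta_2)\barwedge\Delta_3]\vdash\phi$ infer $\Gamma[\Delta_1\barwedge(\Delta_2\barwedge\Delta_3)]\vdash\phi$. For an $\mathcal{L}_\bullet$-sequent $(\sigma)\ \chi\vdash\delta$ with propositional variables among $p_1,\dots,p_n$, the structural rule $(\odot\sigma)$ is: from $\Gamma[\delta[\Delta_1/p_1,\dots,\Delta_n/p_n]]\vdash\phi$ infer $\Gamma[\chi[\Delta_1/p_1,\dots,\Delta_n/p_n]]\vdash\phi$, where $\Delta_1,\dots,\Delta_n$ are arbitrary structures and $\delta[\Delta_1/p_1,\dots]$, $\chi[\Delta_1/p_1,\dots]$ are the structures obtained by uniformly substituting $\Delta_i$ for $p_i$ and $\odot$ for $\bullet$. $\mathsf{G_{BDFNL}}(\odot\Psi)$ is $\mathsf{G_{BDFNL}}$ extended with the rules $(\odot\sigma)$ for all $\sigma\in\Psi$. A bounded distributive lattice-ordered residuated groupoid (BDRG) is an algebra $(A,\wedge,\vee,\top,\bot,\to,\bullet,\leftarrow)$ such that $(A,\wedge,\vee,\top,\bot)$ is a bounded distributive lattice and, for all $a,b,c\in A$: $a\bullet b\le c$ iff $b\le a\to c$ iff $a\le c\leftarrow b$. A consecution $\Gamma\vdash\phi$ is valid in a BDRG if $\mu(\tau(\Gamma))\le\mu(\phi)$ for every assignment $\mu$ in it. $\mathsf{Alg}^+(\Psi)$ is the class of all BDRGs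 in which every sequent of $\Psi$ is valid, and $\mathsf{Alg}^+(\Psi)\models\Gamma\vdash\phi$ means that $\Gamma\vdash\phi$ is valid in every member of this class.
   Formalization: "Valid implies derivable" in (1) assumes no χ in Ψ contains ⊤ (it fails for Ψ={⊤⊢⊥}); in (2) formulas may also be constants ⊤,⊥ that occur in δ but not in χ for some χ⊢δ in Ψ (it fails for p•q⊢p•⊥). -}

module Defs where

open import Data.List using (List; []; _∷_; _++_; concatMap)
open import Data.List.Membership.Propositional using (_∈_; _∉_)
open import Data.List.Relation.Unary.Unique.Propositional using (Unique)
open import Data.Nat using (ℕ)
open import Data.Product using (_×_; _,_; ∃₂)
open import Function.Bundles using (_⇔_)
open import Level using (Level; 0ℓ; suc) renaming (_⊔_ to _⊔ˡ_)
open import Relation.Binary.Core using (Rel)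
open import Relation.Binary.Lattice.Structures using (IsBoundedLattice)
open import Relation.Unary using (Pred)
import Algebra.Definitions as AlgebraDefinitions

infixr 7 _•_
infixr 6 _∧_
infixr 5 _∨_
infixr 4 _⟶_
infixl 4 _⟵_

data Formula : Set where
  var : ℕ → Formula
  ⊤ ⊥ : Formula
  _∧_ _∨_ _⟶_ _•_ _⟵_ : Formula → Formula → Formula

data Formula• : Set where
  var : ℕ → Formula•
  ⊤ ⊥ : Formula•
  _•_ : Formula• → Formula• → Formula•

subformulas : Formula → List Formula
subformulas (var p) = var p ∷ []
subformulas ⊤       = ⊤ ∷ []
subformulas ⊥       = ⊥ ∷ []
subformulas (φ ∧ ψ) = (φ ∧ ψ) ∷ subformulas φ ++ subformulas ψ
subformulas (φ ∨ ψ) = (φ ∨ ψ) ∷ subformulas φ ++ subformulas ψ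
subformulas (φ ⟶ ψ) = (φ ⟶ ψ) ∷ subformulas φ ++ subformulas ψ
subformulas (φ • ψ) = (φ • ψ) ∷ subformulas φ ++ subformulas ψ
subformulas (φ ⟵ ψ) = (φ ⟵ ψ) ∷ subformulas φ ++ subformulas ψ

toFormula : Formula• → Formula
toFormula (var p) = var p
toFormula ⊤       = ⊤
toFormula ⊥       = ⊥
toFormula (χ • δ) = toFormula χ • toFormula δ

-- One entry per occurrence.
vars : Formula• → List ℕ
vars (var p) = p ∷ []
vars ⊤       = []
vars ⊥       = []
vars (χ • δ) = vars χ ++ vars δ

constants : Formula• → List Formula
constants (var p) = []
constants ⊤       = ⊤ ∷ []
constants ⊥       = ⊥ ∷ []
constants (χ • δ) = constants χ ++ constants δ

infix 3 _⊢•_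
record Sequent• : Set where
  constructor _⊢•_
  field
    lhs rhs : Formula•

Good : Sequent• → Set
Good (χ ⊢• δ) = Unique (vars χ)

infixr 7 _⊙_
infixr 6 _⊼_

data Structure : Set where
  ⌜_⌝     : Formula → Structure
  _⊙_ _⊼_ : Structure → Structure → Structure

τ : Structure → Formula
τ ⌜ φ ⌝   = φ
τ (Γ ⊙ Δ) = τ Γ • τ Δ
τ (Γ ⊼ Δ) = τ Γ ∧ τ Δ

formulas : Structure → List Formula
formulas ⌜ φ ⌝   = φ ∷ []
formulas (Γ ⊙ Δ) = formulas Γ ++ formulas Δ
formulas (Γ ⊼ Δ) = formulas Γ ++ formulas Δ

data Context : Set where
  □         : Context
  _⊙ˡ_ _⊼ˡ_ : Context → Structure → Context
  _⊙ʳ_ _⊼ʳ_ : Structure → Context → Context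

infixl 9 _[_]
_[_] : Context → Structure → Structure
□        [ Δ ] = Δ
(Γ ⊙ˡ Σ) [ Δ ] = Γ [ Δ ] ⊙ Σ
(Γ ⊼ˡ Σ) [ Δ ] = Γ [ Δ ] ⊼ Σ
(Σ ⊙ʳ Γ) [ Δ ] = Σ ⊙ Γ [ Δ ]
(Σ ⊼ʳ Γ) [ Δ ] = Σ ⊼ Γ [ Δ ]

-- The substitution s is total, but only its values on variables of the formula matter.
infixl 9 _⟪_⟫
_⟪_⟫ : Formula• → (ℕ → Structure) → Structure
var p   ⟪ s ⟫ = s p
⊤       ⟪ s ⟫ = ⌜ ⊤ ⌝
⊥       ⟪ s ⟫ = ⌜ ⊥ ⌝
(χ • δ) ⟪ s ⟫ = χ ⟪ s ⟫ ⊙ δ ⟪ s ⟫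

infix 3 _⊢_
record Consecution : Set where
  constructor _⊢_
  field
    antecedent : Structure
    succedent  : Formula

-- Derivations in G_BDFNL(⊙Ψ).
infix 2 _▷_
data _▷_ (Ψ : Pred Sequent• 0ℓ) : Consecution → Set where
  id  : ∀ φ → Ψ ▷ ⌜ φ ⌝ ⊢ φ
  ⊤R  : ∀ Γ → Ψ ▷ Γ ⊢ ⊤
  ⊥L  : ∀ Γ φ → Ψ ▷ Γ [ ⌜ ⊥ ⌝ ] ⊢ φ

  ⟶L  : ∀ Γ Δ φ ψ γ → Ψ ▷ Δ ⊢ φ → Ψ ▷ Γ [ ⌜ ψ ⌝ ] ⊢ γ →
        Ψ ▷ Γ [ Δ ⊙ ⌜ φ ⟶ ψ ⌝ ] ⊢ γ
  ⟶R  : ∀ Γ φ ψ → Ψ ▷ ⌜ φ ⌝ ⊙ Γ ⊢ ψ → Ψ ▷ Γ ⊢ φ ⟶ ψ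
  ⟵L  : ∀ Γ Δ φ ψ γ → Ψ ▷ Γ [ ⌜ φ ⌝ ] ⊢ γ → Ψ ▷ Δ ⊢ ψ →
        Ψ ▷ Γ [ ⌜ φ ⟵ ψ ⌝ ⊙ Δ ] ⊢ γ
  ⟵R  : ∀ Γ φ ψ → Ψ ▷ Γ ⊙ ⌜ ψ ⌝ ⊢ φ → Ψ ▷ Γ ⊢ φ ⟵ ψ
  •L  : ∀ Γ φ ψ γ → Ψ ▷ Γ [ ⌜ φ ⌝ ⊙ ⌜ ψ ⌝ ] ⊢ γ → Ψ ▷ Γ [ ⌜ φ • ψ ⌝ ] ⊢ γ
  •R  : ∀ Γ Δ φ ψ → Ψ ▷ Γ ⊢ φ → Ψ ▷ Δ ⊢ ψ → Ψ ▷ Γ ⊙ Δ ⊢ φ • ψ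
  ∧L  : ∀ Γ φ ψ γ → Ψ ▷ Γ [ ⌜ φ ⌝ ⊼ ⌜ ψ ⌝ ] ⊢ γ → Ψ ▷ Γ [ ⌜ φ ∧ ψ ⌝ ] ⊢ γ
  ∧R  : ∀ Γ Δ φ ψ → Ψ ▷ Γ ⊢ φ → Ψ ▷ Δ ⊢ ψ → Ψ ▷ Γ ⊼ Δ ⊢ φ ∧ ψ
  ∨L  : ∀ Γ φ ψ γ → Ψ ▷ Γ [ ⌜ φ ⌝ ] ⊢ γ → Ψ ▷ Γ [ ⌜ ψ ⌝ ] ⊢ γ →
        Ψ ▷ Γ [ ⌜ φ ∨ ψ ⌝ ] ⊢ γ
  ∨R₁ : ∀ Γ φ ψ → Ψ ▷ Γ ⊢ φ → Ψ ▷ Γ ⊢ φ ∨ ψ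
  ∨R₂ : ∀ Γ φ ψ → Ψ ▷ Γ ⊢ ψ → Ψ ▷ Γ ⊢ φ ∨ ψ

  ⊼-contract : ∀ Γ Δ φ → Ψ ▷ Γ [ Δ ⊼ Δ ] ⊢ φ → Ψ ▷ Γ [ Δ ] ⊢ φ
  ⊼-weaken   : ∀ Γ Σ Δ φ → Ψ ▷ Γ [ Δ ] ⊢ φ → Ψ ▷ Γ [ Σ ⊼ Δ ] ⊢ φ
  ⊼-exchange : ∀ Γ Δ Λ φ → Ψ ▷ Γ [ Δ ⊼ Λ ] ⊢ φ → Ψ ▷ Γ [ Λ ⊼ Δ ] ⊢ φ
  ⊼-assoc    : ∀ Γ Δ₁ Δ₂ Δ₃ φ → Ψ ▷ Γ [ (Δ₁ ⊼ Δ₂) ⊼ Δ₃ ] ⊢ φ →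
               Ψ ▷ Γ [ Δ₁ ⊼ (Δ₂ ⊼ Δ₃) ] ⊢ φ

  ⊙-rule : ∀ χ δ → Ψ (χ ⊢• δ) → ∀ Γ (s : ℕ → Structure) φ →
           Ψ ▷ Γ [ δ ⟪ s ⟫ ] ⊢ φ → Ψ ▷ Γ [ χ ⟪ s ⟫ ] ⊢ φ

consecutions  : ∀ {Ψ c} → Ψ ▷ c → List Consecution
strictlyAbove : ∀ {Ψ c} → Ψ ▷ c → List Consecution

consecutions {c = c} d = c ∷ strictlyAbove d

strictlyAbove (id _)                    = []
strictlyAbove (⊤R _)                    = []
strictlyAbove (⊥L _ _)                  = []
strictlyAbove (⟶L _ _ _ _ _ d e)        = consecutions d ++ consecutions e
strictlyAbove (⟶R _ _ _ d)              = consecutions d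
strictlyAbove (⟵L _ _ _ _ _ d e)        = consecutions d ++ consecutions e
strictlyAbove (⟵R _ _ _ d)              = consecutions d
strictlyAbove (•L _ _ _ _ d)            = consecutions d
strictlyAbove (•R _ _ _ _ d e)          = consecutions d ++ consecutions e
strictlyAbove (∧L _ _ _ _ d)            = consecutions d
strictlyAbove (∧R _ _ _ _ d e)          = consecutions d ++ consecutions e
strictlyAbove (∨L _ _ _ _ d e)          = consecutions d ++ consecutions e
strictlyAbove (∨R₁ _ _ _ d)             = consecutions d
strictlyAbove (∨R₂ _ _ _ d)             = consecutions d
strictlyAbove (⊼-contract _ _ _ d)      = consecutions d
strictlyAbove (⊼-weaken _ _ _ _ d)      = consecutions d
strictlyAbove (⊼-exchange _ _ _ _ d)    = consecutions d
strictlyAbove (⊼-assoc _ _ _ _ _ d)     = consecutions d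
strictlyAbove (⊙-rule _ _ _ _ _ _ d)    = consecutions d

formulasOf : Consecution → List Formula
formulasOf (Γ ⊢ φ) = φ ∷ formulas Γ

subformulasOf : Consecution → List Formula
subformulasOf c = concatMap subformulas (formulasOf c)

formulasIn : ∀ {Ψ c} → Ψ ▷ c → List Formula
formulasIn d = concatMap formulasOf (consecutions d)

record BDRG (a ℓ₁ ℓ₂ : Level) : Set (suc (a ⊔ˡ ℓ₁ ⊔ˡ ℓ₂)) where
  infix  4 _≈_ _≤_
  infixr 7 _∙_
  infixr 6 _⊓_
  infixr 5 _⊔_
  infixr 5 _⇒_
  infixl 5 _⇐_
  field
    Carrier          : Set a
    _≈_              : Rel Carrier ℓ₁
    _≤_              : Rel Carrier ℓ₂
    _⊓_ _⊔_          : Carrier → Carrier → Carrier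
    𝟙 𝟘              : Carrier
    _⇒_ _∙_ _⇐_      : Carrier → Carrier → Carrier
    isBoundedLattice : IsBoundedLattice _≈_ _≤_ _⊔_ _⊓_ 𝟙 𝟘
    ⊓-distribˡ-⊔     : AlgebraDefinitions._DistributesOverˡ_ _≈_ _⊓_ _⊔_
    residualʳ        : ∀ a b c → (a ∙ b ≤ c) ⇔ (b ≤ a ⇒ c)
    residualˡ        : ∀ a b c → (a ∙ b ≤ c) ⇔ (a ≤ c ⇐ b)

module _ {a ℓ₁ ℓ₂} (A : BDRG a ℓ₁ ℓ₂) where
  open BDRG A

  ⟦_⟧ : Formula → (ℕ → Carrier) → Carrier
  ⟦ var p ⟧ μ = μ p
  ⟦ ⊤ ⟧     μ = 𝟙
  ⟦ ⊥ ⟧     μ = 𝟘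
  ⟦ φ ∧ ψ ⟧ μ = ⟦ φ ⟧ μ ⊓ ⟦ ψ ⟧ μ
  ⟦ φ ∨ ψ ⟧ μ = ⟦ φ ⟧ μ ⊔ ⟦ ψ ⟧ μ
  ⟦ φ ⟶ ψ ⟧ μ = ⟦ φ ⟧ μ ⇒ ⟦ ψ ⟧ μ
  ⟦ φ • ψ ⟧ μ = ⟦ φ ⟧ μ ∙ ⟦ ψ ⟧ μ
  ⟦ φ ⟵ ψ ⟧ μ = ⟦ φ ⟧ μ ⇐ ⟦ ψ ⟧ μ

  infix 2 _⊨_
  _⊨_ : Consecution → Set (a ⊔ˡ ℓ₂)
  _⊨_ (Γ ⊢ φ) = ∀ μ → ⟦ τ Γ ⟧ μ ≤ ⟦ φ ⟧ μ

Alg⁺ : ∀ {a ℓ₁ ℓ₂} → Pred Sequent• 0ℓ → Pred (BDRG a ℓ₁ ℓ₂) (a ⊔ˡ ℓ₂)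
Alg⁺ Ψ A = ∀ χ δ → Ψ (χ ⊢• δ) → A ⊨ ⌜ toFormula χ ⌝ ⊢ toFormula δ

infix 2 Alg⁺[_,_,_]_⊨_
Alg⁺[_,_,_]_⊨_ : ∀ a ℓ₁ ℓ₂ → Pred Sequent• 0ℓ → Consecution → Set (suc (a ⊔ˡ ℓ₁ ⊔ˡ ℓ₂))
Alg⁺[ a , ℓ₁ , ℓ₂ ] Ψ ⊨ c = ∀ (A : BDRG a ℓ₁ ℓ₂) → Alg⁺ Ψ A → A ⊨ c

-- Completeness fails if ⊤ may occur in a left-hand side.  For Ψ = {⊤ ⊢ ⊥} every
-- member of Alg⁺(Ψ) is trivial, so p ⊢ q is valid; but (⊙σ) only rewrites literal
-- occurrences of ⊤ in the antecedent, and p ⊢ q has no derivation.  Soundness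
-- does not need this condition.
⊤-FreeOnTheLeft : Pred Sequent• 0ℓ → Set
⊤-FreeOnTheLeft Ψ = ∀ χ δ → Ψ (χ ⊢• δ) → ⊤ ∉ constants χ

-- Read upwards, (⊙σ) can introduce a constant that occurs in δ but not in χ, even
-- when vars δ ⊆ vars χ.  For Ψ = {p • q ⊢ p • ⊥}, the consecution p ⊙ q ⊢ r is
-- derivable from the axiom p ⊙ ⊥ ⊢ r.
IntroducedConstant : Pred Sequent• 0ℓ → Formula → Set
IntroducedConstant Ψ θ =
  ∃₂ λ χ δ → Ψ (χ ⊢• δ) × θ ∈ constants δ × θ ∉ constants χ

{-# OPTIONS --safe #-}
module Submission where

-- Soundness is an induction on derivations.  In a BDRG the map x ↦ Γ[x] given by
-- a context is monotone, preserves 𝟘 and preserves binary joins (∙ because it is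
-- residuated, ⊓ because the lattice is distributive), which is what the left
-- rules need.
--
-- Completeness uses no cut elimination.  For a set X of structures let cl X be
-- the set of those Δ such that Γ[Δ] ⊢ φ is derivable whenever Γ[E] ⊢ φ is
-- derivable for every E in X.  This is a closure operator compatible with
-- contexts (cl-bind), and its closed sets form a BDRG (closedSets): products and
-- joins are closures, meets are intersections, and distributivity comes from the
-- structural rules for ⊼.  With var p interpreted as the set of all Σ with Σ ⊢ p,
-- every formula φ satisfies φ ∈ ⟦φ⟧ ⊆ {Σ | Σ ⊢ φ} (self-member, member⇒derivable).
-- Hence Γ ∈ ⟦τ Γ⟧, and ⟦τ Γ⟧ ≤ ⟦φ⟧ yields a derivation of Γ ⊢ φ.  The rule (⊙σ)
-- makes σ valid in the algebra of closed sets: linearity of χ shows that ⟦χ⟧ is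
-- contained in the closure of the substitution instances of χ
-- (interpretation⊆instances), provided that ⊤ does not occur in χ; and a derivation
-- from an instance of δ becomes by (⊙σ) one from the matching instance of χ, so the
-- latter lies in ⟦δ⟧ as the former does.
--
-- Closed sets live one universe too high for a counter-model at arbitrary
-- levels.  Only the elements definable by formulas matter, so the subalgebra that
-- they form is presented with formulas as carrier (definable), which can be
-- lifted to any levels.
--
-- The subformula property is an induction on derivations: going from the
-- conclusion of a rule to a premise creates no new subformula.  In the case of (⊙σ)
-- a structure substituted into δ is also substituted into χ, as the variables of δ
-- occur in χ, so the only exceptions are the constants of δ missing from χ.

open import Defs
open import Data.Empty using (⊥-elim)
open import Data.List using (List; []; _∷_; _++_)
open import Data.List.Membership.Propositional using (_∈_; _∉_)
open import Data.List.Membership.Propositional.Properties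
  using (∈-++⁺ˡ; ∈-++⁺ʳ; ∈-++⁻; ∈-concatMap⁺; ∈-concatMap⁻)
open import Data.List.Relation.Binary.Disjoint.Propositional using (Disjoint)
open import Data.List.Relation.Binary.Subset.Propositional using (_⊆_)
open import Data.List.Relation.Unary.All using (lookup)
import Data.List.Relation.Unary.All.Properties as All
open import Data.List.Relation.Unary.AllPairs using ([]; _∷_)
open import Data.List.Relation.Unary.Any using (Any; here; there; any?)
import Data.List.Relation.Unary.Any.Properties as Any
open import Data.List.Relation.Unary.Unique.Propositional using (Unique)
open import Data.Nat using (ℕ)
import Data.Nat.Properties as ℕ
open import Data.List.Membership.DecPropositional ℕ._≟_ using (_∈?_)
open import Data.Product using (_×_; _,_; proj₁; proj₂)
open import Data.Sum using (_⊎_; inj₁; inj₂; assocʳ; map₁; reduce; swap)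
  renaming (map to ⊎-map; [_,_] to ⊎-elim)
open import Data.Unit using (tt)
open import Function.Base using (_∘_)
open import Function.Bundles using (Equivalence; mk⇔)
open import Level using (Level; 0ℓ; Lift; lift; lower; suc) renaming (_⊔_ to _⊔ˡ_)
open import Relation.Binary.Lattice.Structures using (IsBoundedLattice)
open import Relation.Binary.PropositionalEquality
  using (_≡_; refl; sym; cong; cong₂; subst; subst₂)
open import Relation.Nullary using (Dec; yes; no)
open import Relation.Unary using (Pred; U; ∅; _∪_; _∩_)

-- Soundness

-- Substituting structures and then translating with τ amounts to evaluating under
-- the substituted assignment.
⟦τ⟪⟫⟧ : ∀ {a ℓ₁ ℓ₂} (A : BDRG a ℓ₁ ℓ₂) χ s μ →
        ⟦_⟧ A (τ (χ ⟪ s ⟫)) μ ≡ ⟦_⟧ A (toFormula χ) (λ p → ⟦_⟧ A (τ (s p)) μ)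
⟦τ⟪⟫⟧ A (var p) s μ = refl
⟦τ⟪⟫⟧ A ⊤       s μ = refl
⟦τ⟪⟫⟧ A ⊥       s μ = refl
⟦τ⟪⟫⟧ A (χ • δ) s μ = cong₂ (BDRG._∙_ A) (⟦τ⟪⟫⟧ A χ s μ) (⟦τ⟪⟫⟧ A δ s μ)

module Soundness {a ℓ₁ ℓ₂} (A : BDRG a ℓ₁ ℓ₂) where
  open BDRG A
  open IsBoundedLattice isBoundedLattice
    using (x≤x∨y; y≤x∨y; ∨-least; x∧y≤x; x∧y≤y; ∧-greatest; maximum; minimum)
    renaming (refl to ≤-refl; reflexive to ≤-reflexive; trans to ≤-trans)

  private
    val : Formula → (ℕ → Carrier) → Carrier
    val = ⟦_⟧ A

  residuateʳ : ∀ {x y z} → x ∙ y ≤ z → y ≤ x ⇒ z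
  residuateʳ = Equivalence.to (residualʳ _ _ _)

  unresiduateʳ : ∀ {x y z} → y ≤ x ⇒ z → x ∙ y ≤ z
  unresiduateʳ = Equivalence.from (residualʳ _ _ _)

  residuateˡ : ∀ {x y z} → x ∙ y ≤ z → x ≤ z ⇐ y
  residuateˡ = Equivalence.to (residualˡ _ _ _)

  unresiduateˡ : ∀ {x y z} → x ≤ z ⇐ y → x ∙ y ≤ z
  unresiduateˡ = Equivalence.from (residualˡ _ _ _)

  ∙-monoˡ : ∀ {x y z} → x ≤ y → x ∙ z ≤ y ∙ z
  ∙-monoˡ x≤y = unresiduateˡ (≤-trans x≤y (residuateˡ ≤-refl))

  ∙-monoʳ : ∀ {x y z} → x ≤ y → z ∙ x ≤ z ∙ y
  ∙-monoʳ x≤y = unresiduateʳ (≤-trans x≤y (residuateʳ ≤-refl))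

  ⊓-mono : ∀ {x y u v} → x ≤ y → u ≤ v → x ⊓ u ≤ y ⊓ v
  ⊓-mono x≤y u≤v =
    ∧-greatest (≤-trans (x∧y≤x _ _) x≤y) (≤-trans (x∧y≤y _ _) u≤v)

  ⊔-mono : ∀ {x y u v} → x ≤ y → u ≤ v → x ⊔ u ≤ y ⊔ v
  ⊔-mono x≤y u≤v =
    ∨-least (≤-trans x≤y (x≤x∨y _ _)) (≤-trans u≤v (y≤x∨y _ _))

  ⊓-comm-≤ : ∀ x y → x ⊓ y ≤ y ⊓ x
  ⊓-comm-≤ x y = ∧-greatest (x∧y≤y x y) (x∧y≤x x y)

  ∙-distribʳ-⊔-≤ : ∀ x y z → (x ⊔ y) ∙ z ≤ (x ∙ z) ⊔ (y ∙ z)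
  ∙-distribʳ-⊔-≤ x y z = unresiduateˡ
    (∨-least (residuateˡ (x≤x∨y _ _)) (residuateˡ (y≤x∨y _ _)))

  ∙-distribˡ-⊔-≤ : ∀ x y z → z ∙ (x ⊔ y) ≤ (z ∙ x) ⊔ (z ∙ y)
  ∙-distribˡ-⊔-≤ x y z = unresiduateʳ
    (∨-least (residuateʳ (x≤x∨y _ _)) (residuateʳ (y≤x∨y _ _)))

  ⊓-distribˡ-⊔-≤ : ∀ x y z → z ⊓ (x ⊔ y) ≤ (z ⊓ x) ⊔ (z ⊓ y)
  ⊓-distribˡ-⊔-≤ x y z = ≤-reflexive (⊓-distribˡ-⊔ z x y)

  ⊓-distribʳ-⊔-≤ : ∀ x y z → (x ⊔ y) ⊓ z ≤ (x ⊓ z) ⊔ (y ⊓ z)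
  ⊓-distribʳ-⊔-≤ x y z = ≤-trans (⊓-comm-≤ _ _)
    (≤-trans (⊓-distribˡ-⊔-≤ x y z) (⊔-mono (⊓-comm-≤ _ _) (⊓-comm-≤ _ _)))

  module _ (μ : ℕ → Carrier) where

    context-mono : ∀ Γ {Δ Δ′} → val (τ Δ) μ ≤ val (τ Δ′) μ →
                   val (τ (Γ [ Δ ])) μ ≤ val (τ (Γ [ Δ′ ])) μ
    context-mono □        h = h
    context-mono (Γ ⊙ˡ Σ) h = ∙-monoˡ (context-mono Γ h)
    context-mono (Γ ⊼ˡ Σ) h = ⊓-mono (context-mono Γ h) ≤-refl
    context-mono (Σ ⊙ʳ Γ) h = ∙-monoʳ (context-mono Γ h)
    context-mono (Σ ⊼ʳ Γ) h = ⊓-mono ≤-refl (context-mono Γ h)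

    context-⊥ : ∀ Γ → val (τ (Γ [ ⌜ ⊥ ⌝ ])) μ ≤ 𝟘
    context-⊥ □        = ≤-refl
    context-⊥ (Γ ⊙ˡ Σ) = unresiduateˡ (≤-trans (context-⊥ Γ) (minimum _))
    context-⊥ (Γ ⊼ˡ Σ) = ≤-trans (x∧y≤x _ _) (context-⊥ Γ)
    context-⊥ (Σ ⊙ʳ Γ) = unresiduateʳ (≤-trans (context-⊥ Γ) (minimum _))
    context-⊥ (Σ ⊼ʳ Γ) = ≤-trans (x∧y≤y _ _) (context-⊥ Γ)

    context-∨ : ∀ Γ {φ ψ} → val (τ (Γ [ ⌜ φ ∨ ψ ⌝ ])) μ ≤
                val (τ (Γ [ ⌜ φ ⌝ ])) μ ⊔ val (τ (Γ [ ⌜ ψ ⌝ ])) μ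
    context-∨ □        = ≤-refl
    context-∨ (Γ ⊙ˡ Σ) = ≤-trans (∙-monoˡ (context-∨ Γ)) (∙-distribʳ-⊔-≤ _ _ _)
    context-∨ (Γ ⊼ˡ Σ) =
      ≤-trans (⊓-mono (context-∨ Γ) ≤-refl) (⊓-distribʳ-⊔-≤ _ _ _)
    context-∨ (Σ ⊙ʳ Γ) = ≤-trans (∙-monoʳ (context-∨ Γ)) (∙-distribˡ-⊔-≤ _ _ _)
    context-∨ (Σ ⊼ʳ Γ) =
      ≤-trans (⊓-mono ≤-refl (context-∨ Γ)) (⊓-distribˡ-⊔-≤ _ _ _)

  module _ {Ψ : Pred Sequent• 0ℓ} (A⊨Ψ : Alg⁺ Ψ A) where

    sound : ∀ {c} → Ψ ▷ c → A ⊨ c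
    sound (id φ) μ = ≤-refl
    sound (⊤R Γ) μ = maximum _
    sound (⊥L Γ φ) μ = ≤-trans (context-⊥ μ Γ) (minimum _)
    sound (⟶L Γ Δ φ ψ γ d e) μ = ≤-trans
      (context-mono μ Γ
        (≤-trans (∙-monoˡ (sound d μ)) (unresiduateʳ ≤-refl)))
      (sound e μ)
    sound (⟶R Γ φ ψ d) μ = residuateʳ (sound d μ)
    sound (⟵L Γ Δ φ ψ γ d e) μ = ≤-trans
      (context-mono μ Γ
        (≤-trans (∙-monoʳ (sound e μ)) (unresiduateˡ ≤-refl)))
      (sound d μ)
    sound (⟵R Γ φ ψ d) μ = residuateˡ (sound d μ)
    sound (•L Γ φ ψ γ d) μ =
      ≤-trans (context-mono μ Γ ≤-refl) (sound d μ)
    sound (•R Γ Δ φ ψ d e) μ =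
      ≤-trans (∙-monoˡ (sound d μ)) (∙-monoʳ (sound e μ))
    sound (∧L Γ φ ψ γ d) μ =
      ≤-trans (context-mono μ Γ ≤-refl) (sound d μ)
    sound (∧R Γ Δ φ ψ d e) μ = ⊓-mono (sound d μ) (sound e μ)
    sound (∨L Γ φ ψ γ d e) μ =
      ≤-trans (context-∨ μ Γ) (∨-least (sound d μ) (sound e μ))
    sound (∨R₁ Γ φ ψ d) μ = ≤-trans (sound d μ) (x≤x∨y _ _)
    sound (∨R₂ Γ φ ψ d) μ = ≤-trans (sound d μ) (y≤x∨y _ _)
    sound (⊼-contract Γ Δ φ d) μ =
      ≤-trans (context-mono μ Γ (∧-greatest ≤-refl ≤-refl)) (sound d μ)
    sound (⊼-weaken Γ Σ Δ φ d) μ =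
      ≤-trans (context-mono μ Γ (x∧y≤y _ _)) (sound d μ)
    sound (⊼-exchange Γ Δ Λ φ d) μ =
      ≤-trans (context-mono μ Γ (⊓-comm-≤ _ _)) (sound d μ)
    sound (⊼-assoc Γ Δ₁ Δ₂ Δ₃ φ d) μ = ≤-trans
      (context-mono μ Γ
        (∧-greatest (⊓-mono ≤-refl (x∧y≤x _ _))
                    (≤-trans (x∧y≤y _ _) (x∧y≤y _ _))))
      (sound d μ)
    sound (⊙-rule χ δ σ∈Ψ Γ s φ d) μ =
      ≤-trans (context-mono μ Γ χ≤δ) (sound d μ)
      where
      χ≤δ : val (τ (χ ⟪ s ⟫)) μ ≤ val (τ (δ ⟪ s ⟫)) μ
      χ≤δ = subst₂ _≤_ (sym (⟦τ⟪⟫⟧ A χ s μ)) (sym (⟦τ⟪⟫⟧ A δ s μ))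
              (A⊨Ψ χ δ σ∈Ψ (λ p → val (τ (s p)) μ))

-- The subalgebra of definable elements

-- The subalgebra of A generated by the values ν p of the variables.  An element is
-- represented by a formula defining it, and formulas are compared through their
-- values in A; this makes the carrier independent of the universe of A.
module Definable {a′ ℓ₁′ ℓ₂′} (A : BDRG a′ ℓ₁′ ℓ₂′) (ν : ℕ → BDRG.Carrier A)
                 (a ℓ₁ ℓ₂ : Level) where
  private
    module A = BDRG A
    module L = IsBoundedLattice A.isBoundedLattice

    val : Lift a Formula → A.Carrier
    val x = ⟦_⟧ A (lower x) ν

    op₂ : (Formula → Formula → Formula) →
          Lift a Formula → Lift a Formula → Lift a Formula
    op₂ _⋆_ x y = lift (lower x ⋆ lower y)

  definable : BDRG a (ℓ₁′ ⊔ˡ ℓ₁) (ℓ₂′ ⊔ˡ ℓ₂)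
  definable = record
    { Carrier          = Lift a Formula
    ; _≈_              = λ x y → Lift ℓ₁ (val x A.≈ val y)
    ; _≤_              = λ x y → Lift ℓ₂ (val x A.≤ val y)
    ; _⊓_              = op₂ _∧_
    ; _⊔_              = op₂ _∨_
    ; 𝟙                = lift ⊤
    ; 𝟘                = lift ⊥
    ; _⇒_              = op₂ _⟶_
    ; _∙_              = op₂ _•_
    ; _⇐_              = op₂ _⟵_
    ; isBoundedLattice = record
      { isLattice = record
        { isPartialOrder = record
          { isPreorder = record
            { isEquivalence = record
              { refl  = lift L.Eq.refl
              ; sym   = λ p → lift (L.Eq.sym (lower p))
              ; trans = λ p q → lift (L.Eq.trans (lower p) (lower q))
              }
            ; reflexive = λ p → lift (L.reflexive (lower p))
            ; trans     = λ p q → lift (L.trans (lower p) (lower q))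
            }
          ; antisym = λ p q → lift (L.antisym (lower p) (lower q))
          }
        ; supremum = λ x y →
            lift (L.x≤x∨y _ _) , lift (L.y≤x∨y _ _) ,
            λ z p q → lift (L.∨-least (lower p) (lower q))
        ; infimum = λ x y →
            lift (L.x∧y≤x _ _) , lift (L.x∧y≤y _ _) ,
            λ z p q → lift (L.∧-greatest (lower p) (lower q))
        }
      ; maximum = λ x → lift (L.maximum _)
      ; minimum = λ x → lift (L.minimum _)
      }
    ; ⊓-distribˡ-⊔ = λ x y z → lift (A.⊓-distribˡ-⊔ _ _ _)
    ; residualʳ    = λ x y z →
        mk⇔ (λ p → lift (Equivalence.to   (A.residualʳ _ _ _) (lower p)))
            (λ p → lift (Equivalence.from (A.residualʳ _ _ _) (lower p)))
    ; residualˡ    = λ x y z →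
        mk⇔ (λ p → lift (Equivalence.to   (A.residualˡ _ _ _) (lower p)))
            (λ p → lift (Equivalence.from (A.residualˡ _ _ _) (lower p)))
    }

  -- The inclusion into A is a homomorphism.
  val-⟦⟧ : ∀ φ μ → val (⟦_⟧ definable φ μ) ≡ ⟦_⟧ A φ (λ p → val (μ p))
  val-⟦⟧ (var p) μ = refl
  val-⟦⟧ ⊤       μ = refl
  val-⟦⟧ ⊥       μ = refl
  val-⟦⟧ (φ ∧ ψ) μ = cong₂ A._⊓_ (val-⟦⟧ φ μ) (val-⟦⟧ ψ μ)
  val-⟦⟧ (φ ∨ ψ) μ = cong₂ A._⊔_ (val-⟦⟧ φ μ) (val-⟦⟧ ψ μ)
  val-⟦⟧ (φ ⟶ ψ) μ = cong₂ A._⇒_ (val-⟦⟧ φ μ) (val-⟦⟧ ψ μ)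
  val-⟦⟧ (φ • ψ) μ = cong₂ A._∙_ (val-⟦⟧ φ μ) (val-⟦⟧ ψ μ)
  val-⟦⟧ (φ ⟵ ψ) μ = cong₂ A._⇐_ (val-⟦⟧ φ μ) (val-⟦⟧ ψ μ)

  definable-⊨ : ∀ c → A ⊨ c → definable ⊨ c
  definable-⊨ (Γ ⊢ φ) A⊨c μ = lift
    (subst₂ A._≤_ (sym (val-⟦⟧ (τ Γ) μ)) (sym (val-⟦⟧ φ μ)) (A⊨c (val ∘ μ)))

  -- Validity among definable elements implies truth in A under ν, since every ν p
  -- is definable.
  definable-⊨⁻ : ∀ Γ φ → definable ⊨ Γ ⊢ φ → ⟦_⟧ A (τ Γ) ν A.≤ ⟦_⟧ A φ ν
  definable-⊨⁻ Γ φ h =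
    subst₂ A._≤_ (val-⟦⟧ (τ Γ) generators) (val-⟦⟧ φ generators)
      (lower (h generators))
    where
    generators : ℕ → Lift a Formula
    generators p = lift (var p)

-- Composition of contexts

infixl 8 _⊚_
_⊚_ : Context → Context → Context
□        ⊚ C = C
(Γ ⊙ˡ Σ) ⊚ C = (Γ ⊚ C) ⊙ˡ Σ
(Γ ⊼ˡ Σ) ⊚ C = (Γ ⊚ C) ⊼ˡ Σ
(Σ ⊙ʳ Γ) ⊚ C = Σ ⊙ʳ (Γ ⊚ C)
(Σ ⊼ʳ Γ) ⊚ C = Σ ⊼ʳ (Γ ⊚ C)

⊚-[] : ∀ Γ C Δ → (Γ ⊚ C) [ Δ ] ≡ Γ [ C [ Δ ] ]
⊚-[] □        C Δ = refl
⊚-[] (Γ ⊙ˡ Σ) C Δ = cong (_⊙ Σ) (⊚-[] Γ C Δ)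
⊚-[] (Γ ⊼ˡ Σ) C Δ = cong (_⊼ Σ) (⊚-[] Γ C Δ)
⊚-[] (Σ ⊙ʳ Γ) C Δ = cong (Σ ⊙_) (⊚-[] Γ C Δ)
⊚-[] (Σ ⊼ʳ Γ) C Δ = cong (Σ ⊼_) (⊚-[] Γ C Δ)

-- Linear substitution

⟪⟫-cong : ∀ χ {s t : ℕ → Structure} → (∀ {p} → p ∈ vars χ → s p ≡ t p) →
          χ ⟪ s ⟫ ≡ χ ⟪ t ⟫
⟪⟫-cong (var p) s≗t = s≗t (here refl)
⟪⟫-cong ⊤       s≗t = refl
⟪⟫-cong ⊥       s≗t = refl
⟪⟫-cong (χ • δ) s≗t = cong₂ _⊙_
  (⟪⟫-cong χ (s≗t ∘ ∈-++⁺ˡ)) (⟪⟫-cong δ (s≗t ∘ ∈-++⁺ʳ (vars χ)))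

Unique-++⁻ : ∀ {A : Set} (xs : List A) {ys} → Unique (xs ++ ys) →
             Unique xs × Unique ys × Disjoint xs ys
Unique-++⁻ []       u = [] , u , λ ()
Unique-++⁻ (x ∷ xs) (x∉ ∷ u) with Unique-++⁻ xs u
... | uxs , uys , xs#ys = All.++⁻ˡ xs x∉ ∷ uxs , uys , disjoint
  where
  disjoint : Disjoint (x ∷ xs) _
  disjoint (here refl , v∈ys) = lookup (All.++⁻ʳ xs x∉) v∈ys refl
  disjoint (there v∈xs , v∈ys) = xs#ys (v∈xs , v∈ys)

-- The substitution that agrees with s on the variables of χ and with t elsewhere.
merge : Formula• → (s t : ℕ → Structure) → ℕ → Structure
merge χ s t p with p ∈? vars χ
... | yes _ = s p
... | no  _ = t p

merge-∈ : ∀ χ {s t p} → p ∈ vars χ → merge χ s t p ≡ s p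
merge-∈ χ {p = p} p∈χ with p ∈? vars χ
... | yes _   = refl
... | no  p∉χ = ⊥-elim (p∉χ p∈χ)

merge-∉ : ∀ χ {s t p} → p ∉ vars χ → merge χ s t p ≡ t p
merge-∉ χ {p = p} p∉χ with p ∈? vars χ
... | yes p∈χ = ⊥-elim (p∉χ p∈χ)
... | no  _   = refl

merge-all : ∀ χ {s t} (P : ℕ → Pred Structure 0ℓ) →
            (∀ p → P p (s p)) → (∀ p → P p (t p)) → ∀ p → P p (merge χ s t p)
merge-all χ P Ps Pt p with p ∈? vars χ
... | yes _ = Ps p
... | no  _ = Pt p

module Completeness (Ψ : Pred Sequent• 0ℓ) where

  -- The algebra of closed sets

  -- The closure of a set of structures.
  cl : Pred Structure 0ℓ → Pred Structure 0ℓ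
  cl X Δ = ∀ Γ φ → (∀ E → X E → Ψ ▷ Γ [ E ] ⊢ φ) → Ψ ▷ Γ [ Δ ] ⊢ φ

  cl-unit : ∀ {X Δ} → X Δ → cl X Δ
  cl-unit {Δ = Δ} x Γ φ h = h Δ x

  -- Closure is compatible with contexts: to place C[Δ] in a closure for Δ in cl X,
  -- it suffices to do so for Δ in X.
  cl-bind : ∀ {X Y Δ} C → (∀ E → X E → cl Y (C [ E ])) → cl X Δ → cl Y (C [ Δ ])
  cl-bind {Δ = Δ} C f x Γ φ h = subst (λ Σ → Ψ ▷ Σ ⊢ φ) (⊚-[] Γ C Δ)
    (x (Γ ⊚ C) φ λ E e →
      subst (λ Σ → Ψ ▷ Σ ⊢ φ) (sym (⊚-[] Γ C E)) (f E e Γ φ h))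

  cl-mono : ∀ {X Y Δ} → (∀ E → X E → Y E) → cl X Δ → cl Y Δ
  cl-mono X⊆Y = cl-bind □ (λ E e → cl-unit (X⊆Y E e))

  -- The elements of the algebra: sets of structures that contain their closure.
  record ClosedSet : Set₁ where
    field
      member : Pred Structure 0ℓ
      closed : ∀ {Δ} → cl member Δ → member Δ
  open ClosedSet

  -- A closed set is closed under every rule that rewrites Δ into Δ′ in an arbitrary
  -- context, read from premise to conclusion.
  member-resp : ∀ X {Δ Δ′} → (∀ Γ φ → Ψ ▷ Γ [ Δ ] ⊢ φ → Ψ ▷ Γ [ Δ′ ] ⊢ φ) →
                member X Δ → member X Δ′
  member-resp X {Δ} rule x = closed X (λ Γ φ h → rule Γ φ (h Δ x))

  ⊥-member : ∀ X → member X ⌜ ⊥ ⌝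
  ⊥-member X = closed X (λ Γ φ _ → ⊥L Γ φ)

  ⊼-memberˡ : ∀ X {Δ Λ} → member X Δ → member X (Δ ⊼ Λ)
  ⊼-memberˡ X {Δ} {Λ} = member-resp X
    (λ Γ φ d → ⊼-exchange Γ Λ Δ φ (⊼-weaken Γ Λ Δ φ d))

  ⊼-memberʳ : ∀ X {Δ Λ} → member X Λ → member X (Δ ⊼ Λ)
  ⊼-memberʳ X {Δ} {Λ} = member-resp X (λ Γ φ → ⊼-weaken Γ Δ Λ φ)

  closure : Pred Structure 0ℓ → ClosedSet
  closure X = record { member = cl X ; closed = cl-bind □ (λ _ e → e) }

  -- The elementwise product of two sets of structures.
  data _⊛_ (X Y : Pred Structure 0ℓ) : Pred Structure 0ℓ where
    pair : ∀ {E F} → X E → Y F → (X ⊛ Y) (E ⊙ F)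

  infix 4 _≤ᶜ_
  _≤ᶜ_ : ClosedSet → ClosedSet → Set
  X ≤ᶜ Y = ∀ Δ → member X Δ → member Y Δ

  infixr 7 _∙ᶜ_
  infixr 6 _⊓ᶜ_
  infixr 5 _⊔ᶜ_ _⇒ᶜ_ _⇐ᶜ_
  _⊓ᶜ_ _⊔ᶜ_ _∙ᶜ_ _⇒ᶜ_ _⇐ᶜ_ : ClosedSet → ClosedSet → ClosedSet
  X ⊓ᶜ Y = record
    { member = member X ∩ member Y
    ; closed = λ x → closed X (cl-mono (λ _ → proj₁) x) ,
                     closed Y (cl-mono (λ _ → proj₂) x)
    }
  X ⊔ᶜ Y = closure (member X ∪ member Y)
  X ∙ᶜ Y = closure (member X ⊛ member Y)
  X ⇒ᶜ Y = record
    { member = λ Δ → ∀ E → member X E → member Y (E ⊙ Δ)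
    ; closed = λ d E e →
        closed Y (cl-bind (E ⊙ʳ □) (λ F f → cl-unit (f E e)) d)
    }
  Y ⇐ᶜ X = record
    { member = λ Δ → ∀ E → member X E → member Y (Δ ⊙ E)
    ; closed = λ d E e →
        closed Y (cl-bind (□ ⊙ˡ E) (λ F f → cl-unit (f E e)) d)
    }

  𝟙ᶜ 𝟘ᶜ : ClosedSet
  𝟙ᶜ = record { member = U ; closed = λ _ → tt }
  𝟘ᶜ = closure ∅

  -- For Δ in X and in the closure of Y ∪ Z, duplicate Δ by contraction, keep the
  -- left copy and replace the right one by an E in Y ∪ Z.  By weakening, Δ ⊼ E lies
  -- in X and in whichever of Y and Z contains E.
  ⊓ᶜ-distribˡ-⊔ᶜ : ∀ X Y Z → X ⊓ᶜ (Y ⊔ᶜ Z) ≤ᶜ (X ⊓ᶜ Y) ⊔ᶜ (X ⊓ᶜ Z)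
  ⊓ᶜ-distribˡ-⊔ᶜ X Y Z Δ (x , yz) =
    member-resp ((X ⊓ᶜ Y) ⊔ᶜ (X ⊓ᶜ Z)) (λ Γ φ → ⊼-contract Γ Δ φ)
      (cl-bind (Δ ⊼ʳ □) keep yz)
    where
    keep : ∀ E → (member Y ∪ member Z) E →
           member ((X ⊓ᶜ Y) ⊔ᶜ (X ⊓ᶜ Z)) (Δ ⊼ E)
    keep E (inj₁ y) = cl-unit (inj₁ (⊼-memberˡ X x , ⊼-memberʳ Y y))
    keep E (inj₂ z) = cl-unit (inj₂ (⊼-memberˡ X x , ⊼-memberʳ Z z))

  closedSets : BDRG (suc 0ℓ) 0ℓ 0ℓ
  closedSets = record
    { Carrier          = ClosedSet
    ; _≈_              = λ X Y → X ≤ᶜ Y × Y ≤ᶜ X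
    ; _≤_              = _≤ᶜ_
    ; _⊓_              = _⊓ᶜ_
    ; _⊔_              = _⊔ᶜ_
    ; 𝟙                = 𝟙ᶜ
    ; 𝟘                = 𝟘ᶜ
    ; _⇒_              = _⇒ᶜ_
    ; _∙_              = _∙ᶜ_
    ; _⇐_              = _⇐ᶜ_
    ; isBoundedLattice = record
      { isLattice = record
        { isPartialOrder = record
          { isPreorder = record
            { isEquivalence = record
              { refl  = (λ _ x → x) , (λ _ x → x)
              ; sym   = λ (f , g) → g , f
              ; trans = λ (f , g) (h , k) →
                  (λ Δ → h Δ ∘ f Δ) , (λ Δ → g Δ ∘ k Δ)
              }
            ; reflexive = proj₁
            ; trans     = λ f g Δ → g Δ ∘ f Δ
            }
          ; antisym = _,_
          }
        ; supremum = λ X Y →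
            (λ _ x → cl-unit (inj₁ x)) , (λ _ y → cl-unit (inj₂ y)) ,
            λ Z f g _ xy → closed Z (cl-mono (λ E → ⊎-elim (f E) (g E)) xy)
        ; infimum = λ X Y →
            (λ _ → proj₁) , (λ _ → proj₂) , λ Z f g Δ z → f Δ z , g Δ z
        }
      ; maximum = λ _ _ _ → tt
      ; minimum = λ X _ z → closed X (cl-mono (λ _ ()) z)
      }
    ; ⊓-distribˡ-⊔ = λ X Y Z →
        ⊓ᶜ-distribˡ-⊔ᶜ X Y Z ,
        λ _ xyz → closed (X ⊓ᶜ (Y ⊔ᶜ Z))
          (cl-mono (λ { _ (inj₁ (x , y)) → x , cl-unit (inj₁ y)
                      ; _ (inj₂ (x , z)) → x , cl-unit (inj₂ z) }) xyz)
    ; residualʳ = λ X Y Z → mk⇔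
        (λ f Δ y E x → f (E ⊙ Δ) (cl-unit (pair x y)))
        (λ g _ xy → closed Z
          (cl-mono (λ { _ (pair {E} {F} x y) → g F y E x }) xy))
    ; residualˡ = λ X Y Z → mk⇔
        (λ f Δ x E y → f (Δ ⊙ E) (cl-unit (pair x y)))
        (λ g _ xy → closed Z
          (cl-mono (λ { _ (pair {E} {F} x y) → g E x F y }) xy))
    }

  -- Validity of Ψ in the algebra of closed sets

  val : Formula → (ℕ → ClosedSet) → ClosedSet
  val = ⟦_⟧ closedSets

  -- The substitution instances of χ with Δᵢ taken from the value of pᵢ.
  data Instance (ν : ℕ → ClosedSet) (χ : Formula•) : Pred Structure 0ℓ where
    inst : ∀ s → (∀ p → member (ν p) (s p)) → Instance ν χ (χ ⟪ s ⟫)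

  instance⊆interpretation : ∀ ν δ {s} → (∀ p → member (ν p) (s p)) →
                            member (val (toFormula δ) ν) (δ ⟪ s ⟫)
  instance⊆interpretation ν (var p) s∈ν = s∈ν p
  instance⊆interpretation ν ⊤       s∈ν = tt
  instance⊆interpretation ν ⊥       s∈ν = ⊥-member 𝟘ᶜ
  instance⊆interpretation ν (χ • δ) s∈ν =
    cl-unit (pair (instance⊆interpretation ν χ s∈ν)
                  (instance⊆interpretation ν δ s∈ν))

  instance-• : ∀ ν χ δ {s t} → Disjoint (vars χ) (vars δ) →
               (∀ p → member (ν p) (s p)) → (∀ p → member (ν p) (t p)) →
               Instance ν (χ • δ) (χ ⟪ s ⟫ ⊙ δ ⟪ t ⟫)
  instance-• ν χ δ {s} {t} χ#δ s∈ν t∈ν = subst (Instance ν (χ • δ))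
    (cong₂ _⊙_ (⟪⟫-cong χ (merge-∈ χ))
               (⟪⟫-cong δ (λ p∈δ → merge-∉ χ (λ p∈χ → χ#δ (p∈χ , p∈δ)))))
    (inst (merge χ s t) (merge-all χ (member ∘ ν) s∈ν t∈ν))

  -- This fails for χ = ⊤: the value of ⊤ contains every structure, whereas its only
  -- instance is the formula ⊤ itself.
  interpretation⊆instances : ∀ ν χ → ⊤ ∉ constants χ → Unique (vars χ) →
    ∀ Σ → member (val (toFormula χ) ν) Σ → cl (Instance ν χ) Σ
  interpretation⊆instances ν (var p) _ _ Σ x =
    cl-unit (subst (Instance ν (var p)) (merge-∈ (var p) (here refl))
      -- Closed sets are inhabited by ⊥, which serves as value off p.
      (inst (merge (var p) (λ _ → Σ) (λ _ → ⌜ ⊥ ⌝)) at))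
    where
    at : ∀ q → member (ν q) (merge (var p) (λ _ → Σ) (λ _ → ⌜ ⊥ ⌝) q)
    at q with q ∈? vars (var p)
    ... | yes (here refl) = x
    ... | no  _           = ⊥-member (ν q)
  interpretation⊆instances ν ⊤ ⊤∉ _ Σ x = ⊥-elim (⊤∉ (here refl))
  interpretation⊆instances ν ⊥ _  _ Σ x = cl-mono (λ _ ()) x
  interpretation⊆instances ν (χ • δ) ⊤∉ u Σ x with Unique-++⁻ (vars χ) u
  ... | uχ , uδ , χ#δ = cl-bind □
    (λ { _ (pair {E} {F} e f) →
      cl-bind (□ ⊙ˡ F)
        (λ { _ (inst s s∈ν) →
          cl-bind ((χ ⟪ s ⟫) ⊙ʳ □)
            (λ { _ (inst t t∈ν) → cl-unit (instance-• ν χ δ χ#δ s∈ν t∈ν) })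
            (interpretation⊆instances ν δ (⊤∉ ∘ ∈-++⁺ʳ (constants χ)) uδ F f) })
        (interpretation⊆instances ν χ (⊤∉ ∘ ∈-++⁺ˡ) uχ E e) })
    x

  closedSets-Alg⁺ : (∀ σ → Ψ σ → Good σ) → ⊤-FreeOnTheLeft Ψ → Alg⁺ Ψ closedSets
  closedSets-Alg⁺ good ⊤-free χ δ σ∈Ψ ν Σ x =
    closed (val (toFormula δ) ν) (cl-bind □ rewriteInstance
      (interpretation⊆instances ν χ (⊤-free χ δ σ∈Ψ) (good _ σ∈Ψ) Σ x))
    where
    rewriteInstance : ∀ E → Instance ν χ E → cl (member (val (toFormula δ) ν)) E
    rewriteInstance _ (inst s s∈ν) Γ φ h = ⊙-rule χ δ σ∈Ψ Γ s φ
      (h (δ ⟪ s ⟫) (instance⊆interpretation ν δ s∈ν))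

  -- The canonical assignment

  -- The structures that entail φ.
  derivable : Formula → ClosedSet
  derivable φ = record
    { member = λ Σ → Ψ ▷ Σ ⊢ φ
    ; closed = λ x → x □ φ (λ _ d → d)
    }

  -- The assignment for which the value of each formula φ lies between the singleton
  -- of φ and derivable φ.
  canonical : ℕ → ClosedSet
  canonical p = derivable (var p)

  -- The two inclusions depend on each other: a left rule for an implication needs a
  -- derivation of its antecedent, a right rule needs the membership of that formula.
  mutual
    self-member : ∀ φ → member (val φ canonical) ⌜ φ ⌝
    self-member (var p) = id (var p)
    self-member ⊤       = tt
    self-member ⊥       = ⊥-member 𝟘ᶜ
    self-member (φ ∧ ψ) =
      member-resp (val φ canonical ⊓ᶜ val ψ canonical) (λ Γ → ∧L Γ φ ψ)
        (⊼-memberˡ (val φ canonical) (self-member φ) ,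
         ⊼-memberʳ (val ψ canonical) (self-member ψ))
    self-member (φ ∨ ψ) Γ γ h =
      ∨L Γ φ ψ γ (h _ (inj₁ (self-member φ))) (h _ (inj₂ (self-member ψ)))
    self-member (φ ⟶ ψ) E e = member-resp (val ψ canonical)
      (λ Γ γ → ⟶L Γ E φ ψ γ (member⇒derivable φ E e)) (self-member ψ)
    self-member (φ • ψ) =
      member-resp (val φ canonical ∙ᶜ val ψ canonical) (λ Γ → •L Γ φ ψ)
        (cl-unit (pair (self-member φ) (self-member ψ)))
    self-member (φ ⟵ ψ) E e = member-resp (val φ canonical)
      (λ Γ γ d → ⟵L Γ E φ ψ γ d (member⇒derivable ψ E e)) (self-member φ)

    member⇒derivable : ∀ φ → val φ canonical ≤ᶜ derivable φ
    member⇒derivable (var p) Σ d = d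
    member⇒derivable ⊤       Σ _ = ⊤R Σ
    member⇒derivable ⊥       Σ x = x □ ⊥ (λ _ ())
    member⇒derivable (φ ∧ ψ) Σ (x , y) = ⊼-contract □ Σ (φ ∧ ψ)
      (∧R Σ Σ φ ψ (member⇒derivable φ Σ x) (member⇒derivable ψ Σ y))
    member⇒derivable (φ ∨ ψ) Σ x = x □ (φ ∨ ψ)
      λ { E (inj₁ e) → ∨R₁ E φ ψ (member⇒derivable φ E e)
        ; E (inj₂ e) → ∨R₂ E φ ψ (member⇒derivable ψ E e) }
    member⇒derivable (φ ⟶ ψ) Σ x = ⟶R Σ φ ψ
      (member⇒derivable ψ (⌜ φ ⌝ ⊙ Σ) (x ⌜ φ ⌝ (self-member φ)))
    member⇒derivable (φ • ψ) Σ x = x □ (φ • ψ)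
      λ { _ (pair {E} {F} e f) →
          •R E F φ ψ (member⇒derivable φ E e) (member⇒derivable ψ F f) }
    member⇒derivable (φ ⟵ ψ) Σ x = ⟵R Σ φ ψ
      (member⇒derivable φ (Σ ⊙ ⌜ ψ ⌝) (x ⌜ ψ ⌝ (self-member ψ)))

  structure-member : ∀ Γ → member (val (τ Γ) canonical) Γ
  structure-member ⌜ φ ⌝   = self-member φ
  structure-member (Γ ⊙ Δ) = cl-unit (pair (structure-member Γ) (structure-member Δ))
  structure-member (Γ ⊼ Δ) =
    ⊼-memberˡ (val (τ Γ) canonical) (structure-member Γ) ,
    ⊼-memberʳ (val (τ Δ) canonical) (structure-member Δ)

  complete : ∀ a ℓ₁ ℓ₂ → (∀ σ → Ψ σ → Good σ) → ⊤-FreeOnTheLeft Ψ →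
             ∀ c → Alg⁺[ a , ℓ₁ , ℓ₂ ] Ψ ⊨ c → Ψ ▷ c
  complete a ℓ₁ ℓ₂ good ⊤-free (Γ ⊢ φ) valid =
    member⇒derivable φ Γ (definable-⊨⁻ Γ φ (valid definable inAlg⁺) Γ
      (structure-member Γ))
    where
    open Definable closedSets canonical a ℓ₁ ℓ₂
    inAlg⁺ : Alg⁺ Ψ definable
    inAlg⁺ χ δ σ∈Ψ = definable-⊨ (⌜ toFormula χ ⌝ ⊢ toFormula δ)
      (closedSets-Alg⁺ good ⊤-free χ δ σ∈Ψ)

-- The subformula property

∈-subformulas-refl : ∀ φ → φ ∈ subformulas φ
∈-subformulas-refl (var p) = here refl
∈-subformulas-refl ⊤       = here refl
∈-subformulas-refl ⊥       = here refl
∈-subformulas-refl (φ ∧ ψ) = here refl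
∈-subformulas-refl (φ ∨ ψ) = here refl
∈-subformulas-refl (φ ⟶ ψ) = here refl
∈-subformulas-refl (φ • ψ) = here refl
∈-subformulas-refl (φ ⟵ ψ) = here refl

-- θ is a subformula of some formula in the structure.
infix 4 _≺_
_≺_ : Formula → Structure → Set
θ ≺ ⌜ φ ⌝   = θ ∈ subformulas φ
θ ≺ (Γ ⊙ Δ) = θ ≺ Γ ⊎ θ ≺ Δ
θ ≺ (Γ ⊼ Δ) = θ ≺ Γ ⊎ θ ≺ Δ

≺⇒Any : ∀ {θ} Γ → θ ≺ Γ → Any ((θ ∈_) ∘ subformulas) (formulas Γ)
≺⇒Any ⌜ φ ⌝   θ≺ = here θ≺
≺⇒Any (Γ ⊙ Δ) (inj₁ θ≺) = Any.++⁺ˡ (≺⇒Any Γ θ≺)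
≺⇒Any (Γ ⊙ Δ) (inj₂ θ≺) = Any.++⁺ʳ (formulas Γ) (≺⇒Any Δ θ≺)
≺⇒Any (Γ ⊼ Δ) (inj₁ θ≺) = Any.++⁺ˡ (≺⇒Any Γ θ≺)
≺⇒Any (Γ ⊼ Δ) (inj₂ θ≺) = Any.++⁺ʳ (formulas Γ) (≺⇒Any Δ θ≺)

∈⇒≺ : ∀ {θ} Γ → θ ∈ formulas Γ → θ ≺ Γ
∈⇒≺ ⌜ φ ⌝   (here refl) = ∈-subformulas-refl φ
∈⇒≺ (Γ ⊙ Δ) θ∈ = ⊎-map (∈⇒≺ Γ) (∈⇒≺ Δ) (∈-++⁻ (formulas Γ) θ∈)
∈⇒≺ (Γ ⊼ Δ) θ∈ = ⊎-map (∈⇒≺ Γ) (∈⇒≺ Δ) (∈-++⁻ (formulas Γ) θ∈)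

-- θ is a subformula of some formula in the consecution.
infix 4 _◁_
data _◁_ (θ : Formula) : Consecution → Set where
  right : ∀ {Γ φ} → θ ∈ subformulas φ → θ ◁ (Γ ⊢ φ)
  left  : ∀ {Γ φ} → θ ≺ Γ → θ ◁ (Γ ⊢ φ)

◁⇒∈ : ∀ {θ} c → θ ◁ c → θ ∈ subformulasOf c
◁⇒∈ (Γ ⊢ φ) (right θ∈φ) = ∈-concatMap⁺ subformulas {xs = φ ∷ formulas Γ}
  (here θ∈φ)
◁⇒∈ (Γ ⊢ φ) (left  θ≺Γ) = ∈-concatMap⁺ subformulas {xs = φ ∷ formulas Γ}
  (there (≺⇒Any Γ θ≺Γ))

∈⇒◁ : ∀ {θ} c → θ ∈ formulasOf c → θ ◁ c
∈⇒◁ (Γ ⊢ φ) (here refl) = right (∈-subformulas-refl φ)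
∈⇒◁ (Γ ⊢ φ) (there θ∈Γ) = left (∈⇒≺ Γ θ∈Γ)

≺-fill : ∀ {θ} Γ {Δ} → θ ≺ Δ → θ ≺ Γ [ Δ ]
≺-fill □        h = h
≺-fill (Γ ⊙ˡ Σ) h = inj₁ (≺-fill Γ h)
≺-fill (Γ ⊼ˡ Σ) h = inj₁ (≺-fill Γ h)
≺-fill (Σ ⊙ʳ Γ) h = inj₂ (≺-fill Γ h)
≺-fill (Σ ⊼ʳ Γ) h = inj₂ (≺-fill Γ h)

-- The alternative Q allows for subformulas that the replacement introduces.
≺-replace : ∀ {θ} {Q : Set} Γ {Δ′ Δ} → (θ ≺ Δ′ → θ ≺ Δ ⊎ Q) →
            θ ≺ Γ [ Δ′ ] → θ ≺ Γ [ Δ ] ⊎ Q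
≺-replace □        f h        = f h
≺-replace (Γ ⊙ˡ Σ) f (inj₁ h) = map₁ inj₁ (≺-replace Γ f h)
≺-replace (Γ ⊙ˡ Σ) f (inj₂ h) = inj₁ (inj₂ h)
≺-replace (Γ ⊼ˡ Σ) f (inj₁ h) = map₁ inj₁ (≺-replace Γ f h)
≺-replace (Γ ⊼ˡ Σ) f (inj₂ h) = inj₁ (inj₂ h)
≺-replace (Σ ⊙ʳ Γ) f (inj₁ h) = inj₁ (inj₁ h)
≺-replace (Σ ⊙ʳ Γ) f (inj₂ h) = map₁ inj₂ (≺-replace Γ f h)
≺-replace (Σ ⊼ʳ Γ) f (inj₁ h) = inj₁ (inj₁ h)
≺-replace (Σ ⊼ʳ Γ) f (inj₂ h) = map₁ inj₂ (≺-replace Γ f h)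

≺-var : ∀ {θ p s} χ → p ∈ vars χ → θ ≺ s p → θ ≺ χ ⟪ s ⟫
≺-var (var p) (here refl) h = h
≺-var (χ • δ) p∈ h =
  ⊎-map (λ p∈χ → ≺-var χ p∈χ h) (λ p∈δ → ≺-var δ p∈δ h) (∈-++⁻ (vars χ) p∈)

≺-constant : ∀ {θ s} χ → θ ∈ constants χ → θ ≺ χ ⟪ s ⟫
≺-constant ⊤ (here refl) = here refl
≺-constant ⊥ (here refl) = here refl
≺-constant (χ • δ) θ∈ = ⊎-map (≺-constant χ) (≺-constant δ) (∈-++⁻ (constants χ) θ∈)

⊤≟ : (φ : Formula) → Dec (⊤ ≡ φ)
⊤≟ ⊤       = yes refl
⊤≟ (var p) = no λ ()
⊤≟ ⊥       = no λ ()
⊤≟ (φ ∧ ψ) = no λ ()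
⊤≟ (φ ∨ ψ) = no λ ()
⊤≟ (φ ⟶ ψ) = no λ ()
⊤≟ (φ • ψ) = no λ ()
⊤≟ (φ ⟵ ψ) = no λ ()

⊥≟ : (φ : Formula) → Dec (⊥ ≡ φ)
⊥≟ ⊥       = yes refl
⊥≟ (var p) = no λ ()
⊥≟ ⊤       = no λ ()
⊥≟ (φ ∧ ψ) = no λ ()
⊥≟ (φ ∨ ψ) = no λ ()
⊥≟ (φ ⟶ ψ) = no λ ()
⊥≟ (φ • ψ) = no λ ()
⊥≟ (φ ⟵ ψ) = no λ ()

module Subformula (Ψ : Pred Sequent• 0ℓ)
                  (vars⊆ : ∀ χ δ → Ψ (χ ⊢• δ) → vars δ ⊆ vars χ) where

  ⊙-rule-≺ : ∀ {θ} χ δ {s} → Ψ (χ ⊢• δ) → θ ≺ δ ⟪ s ⟫ →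
             θ ≺ χ ⟪ s ⟫ ⊎ IntroducedConstant Ψ θ
  ⊙-rule-≺ {θ} χ δ {s} σ∈Ψ = go δ (vars⊆ χ δ σ∈Ψ) (λ θ∈ → θ∈)
    where
    constant : Dec (θ ∈ constants χ) → θ ∈ constants δ →
               θ ≺ χ ⟪ s ⟫ ⊎ IntroducedConstant Ψ θ
    constant (yes θ∈χ) θ∈δ = inj₁ (≺-constant χ θ∈χ)
    constant (no  θ∉χ) θ∈δ = inj₂ (χ , δ , σ∈Ψ , θ∈δ , θ∉χ)

    -- The induction runs over the parts ε of δ.
    go : ∀ ε → vars ε ⊆ vars χ → constants ε ⊆ constants δ → θ ≺ ε ⟪ s ⟫ →
         θ ≺ χ ⟪ s ⟫ ⊎ IntroducedConstant Ψ θ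
    go (var p) v c h = inj₁ (≺-var χ (v (here refl)) h)
    go ⊤ v c (here refl) = constant (any? ⊤≟ (constants χ)) (c (here refl))
    go ⊥ v c (here refl) = constant (any? ⊥≟ (constants χ)) (c (here refl))
    go (ε₁ • ε₂) v c (inj₁ h) = go ε₁ (v ∘ ∈-++⁺ˡ) (c ∘ ∈-++⁺ˡ) h
    go (ε₁ • ε₂) v c (inj₂ h) =
      go ε₂ (v ∘ ∈-++⁺ʳ (vars ε₁)) (c ∘ ∈-++⁺ʳ (constants ε₁)) h

  -- Every subformula of c′ is a subformula of c or an introduced constant.
  infix 4 _≼_
  _≼_ : Consecution → Consecution → Set
  c′ ≼ c = ∀ {θ} → θ ◁ c′ → θ ◁ c ⊎ IntroducedConstant Ψ θ

  ≼-trans : ∀ {c₁ c₂ c₃} → c₁ ≼ c₂ → c₂ ≼ c₃ → c₁ ≼ c₃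
  ≼-trans c₁≼c₂ c₂≼c₃ h = ⊎-elim c₂≼c₃ inj₂ (c₁≼c₂ h)

  -- A premise that differs from the conclusion inside a context of the antecedent.
  ≼-replace : ∀ Γ {Δ′ Δ γ} → (∀ {θ} → θ ≺ Δ′ → θ ≺ Δ) →
              (Γ [ Δ′ ] ⊢ γ) ≼ (Γ [ Δ ] ⊢ γ)
  ≼-replace Γ f (right h) = inj₁ (right h)
  ≼-replace Γ f (left  h) = map₁ left (≺-replace Γ (inj₁ ∘ f) h)

  -- A premise all of whose subformulas occur in what fills the hole of the
  -- conclusion.
  ≼-fill : ∀ Γ {Δ φ Δ′ γ} → (∀ {θ} → θ ◁ (Δ ⊢ φ) → θ ≺ Δ′) →
           (Δ ⊢ φ) ≼ (Γ [ Δ′ ] ⊢ γ)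
  ≼-fill Γ f h = inj₁ (left (≺-fill Γ (f h)))

  ∈ˡ : ∀ {θ κ : Formula} {xs ys} → θ ∈ xs → θ ∈ κ ∷ xs ++ ys
  ∈ˡ h = there (∈-++⁺ˡ h)

  ∈ʳ : ∀ {θ κ : Formula} xs {ys} → θ ∈ ys → θ ∈ κ ∷ xs ++ ys
  ∈ʳ xs h = there (∈-++⁺ʳ xs h)

  mutual
    consecutions-≼ : ∀ {c} (d : Ψ ▷ c) {c′} → c′ ∈ consecutions d → c′ ≼ c
    consecutions-≼ d (here refl)  h = inj₁ h
    consecutions-≼ d (there c′∈d) h = strictlyAbove-≼ d c′∈d h

    strictlyAbove-≼ : ∀ {c} (d : Ψ ▷ c) {c′} → c′ ∈ strictlyAbove d → c′ ≼ c
    strictlyAbove-≼ (⟶L Γ Δ φ ψ γ d e) = twoPremises d e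
      (≼-fill Γ λ { (right h) → inj₂ (∈ˡ h) ; (left h) → inj₁ h })
      (≼-replace Γ (inj₂ ∘ ∈ʳ (subformulas φ)))
    strictlyAbove-≼ (⟶R Γ φ ψ d) = onePremise d
      λ { (right h)       → inj₁ (right (∈ʳ (subformulas φ) h))
        ; (left (inj₁ h)) → inj₁ (right (∈ˡ h))
        ; (left (inj₂ h)) → inj₁ (left h) }
    strictlyAbove-≼ (⟵L Γ Δ φ ψ γ d e) = twoPremises d e
      (≼-replace Γ (inj₁ ∘ ∈ˡ))
      (≼-fill Γ λ { (right h) → inj₁ (∈ʳ (subformulas φ) h) ; (left h) → inj₂ h })
    strictlyAbove-≼ (⟵R Γ φ ψ d) = onePremise d
      λ { (right h)       → inj₁ (right (∈ˡ h))
        ; (left (inj₁ h)) → inj₁ (left h)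
        ; (left (inj₂ h)) → inj₁ (right (∈ʳ (subformulas φ) h)) }
    strictlyAbove-≼ (•L Γ φ ψ γ d) = onePremise d
      (≼-replace Γ (⊎-elim ∈ˡ (∈ʳ (subformulas φ))))
    strictlyAbove-≼ (•R Γ Δ φ ψ d e) = twoPremises d e
      (λ { (right h) → inj₁ (right (∈ˡ h)) ; (left h) → inj₁ (left (inj₁ h)) })
      (λ { (right h) → inj₁ (right (∈ʳ (subformulas φ) h))
         ; (left h)  → inj₁ (left (inj₂ h)) })
    strictlyAbove-≼ (∧L Γ φ ψ γ d) = onePremise d
      (≼-replace Γ (⊎-elim ∈ˡ (∈ʳ (subformulas φ))))
    strictlyAbove-≼ (∧R Γ Δ φ ψ d e) = twoPremises d e
      (λ { (right h) → inj₁ (right (∈ˡ h)) ; (left h) → inj₁ (left (inj₁ h)) })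
      (λ { (right h) → inj₁ (right (∈ʳ (subformulas φ) h))
         ; (left h)  → inj₁ (left (inj₂ h)) })
    strictlyAbove-≼ (∨L Γ φ ψ γ d e) = twoPremises d e
      (≼-replace Γ ∈ˡ) (≼-replace Γ (∈ʳ (subformulas φ)))
    strictlyAbove-≼ (∨R₁ Γ φ ψ d) = onePremise d
      λ { (right h) → inj₁ (right (∈ˡ h)) ; (left h) → inj₁ (left h) }
    strictlyAbove-≼ (∨R₂ Γ φ ψ d) = onePremise d
      λ { (right h) → inj₁ (right (∈ʳ (subformulas φ) h)) ; (left h) → inj₁ (left h) }
    strictlyAbove-≼ (⊼-contract Γ Δ φ d) = onePremise d
      (≼-replace Γ reduce)
    strictlyAbove-≼ (⊼-weaken Γ Σ Δ φ d) = onePremise d (≼-replace Γ inj₂)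
    strictlyAbove-≼ (⊼-exchange Γ Δ Λ φ d) = onePremise d
      (≼-replace Γ swap)
    strictlyAbove-≼ (⊼-assoc Γ Δ₁ Δ₂ Δ₃ φ d) = onePremise d
      (≼-replace Γ assocʳ)
    strictlyAbove-≼ (⊙-rule χ δ σ∈Ψ Γ s φ d) = onePremise d
      λ { (right h) → inj₁ (right h)
        ; (left h)  → map₁ left (≺-replace Γ (⊙-rule-≺ χ δ σ∈Ψ) h) }

    onePremise : ∀ {c₁ c} (d : Ψ ▷ c₁) → c₁ ≼ c →
                 ∀ {c′} → c′ ∈ consecutions d → c′ ≼ c
    onePremise d step c′∈d = ≼-trans (consecutions-≼ d c′∈d) step

    twoPremises : ∀ {c₁ c₂ c} (d : Ψ ▷ c₁) (e : Ψ ▷ c₂) → c₁ ≼ c → c₂ ≼ c →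
                  ∀ {c′} → c′ ∈ consecutions d ++ consecutions e → c′ ≼ c
    twoPremises d e step₁ step₂ c′∈ with ∈-++⁻ (consecutions d) c′∈
    ... | inj₁ c′∈d = onePremise d step₁ c′∈d
    ... | inj₂ c′∈e = onePremise e step₂ c′∈e

  formulasOf-≼ : ∀ {θ c} cs → (∀ {c′} → c′ ∈ cs → c′ ≼ c) →
                 Any ((θ ∈_) ∘ formulasOf) cs → θ ◁ c ⊎ IntroducedConstant Ψ θ
  formulasOf-≼ (c′ ∷ cs) cs≼c (here θ∈c′) = cs≼c (here refl) (∈⇒◁ c′ θ∈c′)
  formulasOf-≼ (c′ ∷ cs) cs≼c (there θ∈)  = formulasOf-≼ cs (cs≼c ∘ there) θ∈

  subformulaProperty : ∀ c (d : Ψ ▷ c) θ → θ ∈ formulasIn d →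
                       θ ∈ subformulasOf c ⊎ IntroducedConstant Ψ θ
  subformulaProperty c d θ θ∈d = map₁ (◁⇒∈ c)
    (formulasOf-≼ (consecutions d) (consecutions-≼ d)
      (∈-concatMap⁻ formulasOf {xs = consecutions d} θ∈d))

theorem14 : ∀ (Ψ : Pred Sequent• 0ℓ) (a ℓ₁ ℓ₂ : Level) →
    (∀ σ → Ψ σ → Good σ) →
    ((∀ c → Ψ ▷ c → Alg⁺[ a , ℓ₁ , ℓ₂ ] Ψ ⊨ c) ×
    (⊤-FreeOnTheLeft Ψ → ∀ c → Alg⁺[ a , ℓ₁ , ℓ₂ ] Ψ ⊨ c → Ψ ▷ c)) ×
    ((∀ χ δ → Ψ (χ ⊢• δ) → vars δ ⊆ vars χ) →
    ∀ c (d : Ψ ▷ c) θ → θ ∈ formulasIn d →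
    θ ∈ subformulasOf c ⊎ IntroducedConstant Ψ θ)
theorem14 Ψ a ℓ₁ ℓ₂ good =
  ((λ c d A A⊨Ψ → Soundness.sound A A⊨Ψ d) ,
   (λ ⊤-free → Completeness.complete Ψ a ℓ₁ ℓ₂ good ⊤-free)) ,
  (λ vars⊆ → Subformula.subformulaProperty Ψ vars⊆)
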